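{- With respect to the class of all frames that are forward, backward, downward and upward confluent, the class of all symmetric frames is not modally definable.
   Context: Syntax. $\mathbf{At}=\{p_i : i\in\mathbb{N}\}$ is a countable set of atoms (enumerated without repetition). The set $\mathbf{Fo}$ of formulas is generated by $A ::= p \mid (A\rightharpoonup A)\mid (A\leftharpoondown A)\mid \top\mid\bot\mid (A\vee A)\mid (A\wedge A)\mid \lozenge A\mid\square A\mid⧫ A\mid\blacksquare A$, with $p\in\mathbf{At}$. A signed formula is a pair $(\alpha,A)$ with $\alpha\in\{+,-\}$ and $A\in\mathbf{Fo}$. Semantics. A frame is a triple $(W,\leq,R)$ where $W\neq\emptyset$, $\leq$ is a preorder on $W$ and $R$ is a binary relation on $W$; $\geq$ is the converse of $\leq$. A valuation is a function $V:\mathbf{At}\to\wp(W)$ such that each $V(p)$ is $\leq$-closed (if $s\in V(p)$ and $s\leq t$ then $t\in V(p)$). A model based on $(W,\leq,R)$ is $(W,\leq,R,V)$ with $V$ a valuation. Satisfaction at $s\in W$: $s\models p$ iff $s\in V(p)$; $s\models\top$; $s\not\models\bot$; $\vee,\wedge$ as usual pointwise; - $s\models A\rightharpoonup B$ iff for all $t\geq s$, $t\not\models A$ or $t\models B$; - $s\models A\leftharpoondown B$ iff there is $t\leq s$ with $t\not\models A$ and $t\models B$; - $s\models\lozenge A$ iff there are $t\leq s$ and $u$ with $tRu$ and $u\models A$; - $s\models\square A$ iff for all $t\geq s$ and all $u$, $tRu$ implies $u\models A$; - $s\models⧫ A$ iff for all $t\geq s$ there is $u$ with $tRu$ and $u\models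 A$; - $s\models\blacksquare A$ iff there is $t\leq s$ such that for all $u$, $tRu$ implies $u\models A$. Further, $s\models(+,A)$ iff $s\models A$, and $s\models(-,A)$ iff $s\not\models A$. A signed formula is valid in a frame if it is satisfied at every point of every model based on the frame. Composition: $s(R\circ S)t$ iff there is $u$ with $sRu$ and $uSt$. A frame is forward confluent if ${\geq}\circ R\subseteq R\circ{\geq}$; backward confluent if $R\circ{\leq}\subseteq{\leq}\circ R$; downward confluent if ${\leq}\circ R\subseteq R\circ{\leq}$; upward confluent if $R\circ{\geq}\subseteq{\geq}\circ R$; symmetric if $sRt$ implies $tRs$ for all $s,t\in W$. Definability. An inference rule consists of $m\in\mathbb{N}$ signed formulas $(\alpha_1,A_1),\dots,(\alpha_m,A_m)$ (premises) and a signed formula $(\beta,B)$ (conclusion). A frame respects the rule if: whenever all premises are valid in the frame, the conclusion is valid in the frame. A class $\mathcal{C}$ of frames is modally definable with respect to a class $\mathcal{D}$ of frames if there is an inference rule such that every frame in $\mathcal{D}$ respects the rule iff it is in $\mathcal{C}$. -}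

module Defs where

open import Data.Empty.Polymorphic using (⊥)
open import Data.List.Base using (List)
open import Data.List.Relation.Unary.All using (All)
open import Data.Nat.Base using (ℕ)
open import Data.Product.Base using (Σ-syntax; ∃-syntax; _×_; _,_)
open import Data.Sign.Base using (Sign)
open import Data.Sum.Base using (_⊎_)
open import Data.Unit.Polymorphic using (⊤)
open import Function.Base using (flip)
open import Function.Bundles using (_⇔_)
open import Level using (Level; _⊔_) renaming (suc to lsuc)
-- The composition symbol is U+037E, not an ASCII semicolon.
open import Relation.Binary.Construct.Composition using (_;_)
open import Relation.Binary.Core using (Rel; _⇒_)
open import Relation.Binary.Definitions using (Symmetric; _Respects_)
open import Relation.Binary.PropositionalEquality.Core using (_≡_)
open import Relation.Binary.Structures using (IsPreorder)
open import Relation.Nullary.Negation.Core using (¬_)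
open import Relation.Unary using (Pred; _∈_; _∩_)

private
  variable
    ℓ c d : Level

-- The number i stands for the atom pᵢ.
At : Set
At = ℕ

infixr 5 _⇀_ _↽_
infixr 6 _∨_
infixr 7 _∧_
infix  8 ◇_ □_ ⧫_ ■_

data Fo : Set where
  atom            : At → Fo
  _⇀_ _↽_         : Fo → Fo → Fo
  ⊤′ ⊥′           : Fo
  _∨_ _∧_         : Fo → Fo → Fo
  ◇_ □_ ⧫_ ■_     : Fo → Fo

SignedFo : Set
SignedFo = Sign × Fo

record Frame (ℓ : Level) : Set (lsuc ℓ) where
  infix 4 _≤_ _≥_
  field
    W          : Set ℓ
    nonempty   : W
    _≤_        : Rel W ℓ
    isPreorder : IsPreorder _≡_ _≤_
    R          : Rel W ℓ

  _≥_ : Rel W ℓ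
  _≥_ = flip _≤_

record Valuation (F : Frame ℓ) : Set (lsuc ℓ) where
  open Frame F
  field
    V      : At → Pred W ℓ
    closed : ∀ p → V p Respects _≤_

record Model (ℓ : Level) : Set (lsuc ℓ) where
  constructor _,ᵐ_
  field
    frame     : Frame ℓ
    valuation : Valuation frame

  open Frame frame public
  open Valuation valuation public

-- The metatheory of the semantics is classical.  The clauses are transcribed
-- literally (in particular "t ⊭ A or t ⊨ B" for ⇀), and excluded middle is
-- not assumed.
infix 4 _⊩_⊨_ _⊩_⊨ˢ_

_⊩_⊨_ : (M : Model ℓ) → Model.W M → Fo → Set ℓ
M ⊩ s ⊨ atom p = s ∈ Model.V M p
M ⊩ s ⊨ A ⇀ B  = let open Model M in ∀ t → t ≥ s → ¬ (M ⊩ t ⊨ A) ⊎ M ⊩ t ⊨ B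
M ⊩ s ⊨ A ↽ B  = let open Model M in ∃[ t ] t ≤ s × ¬ (M ⊩ t ⊨ A) × M ⊩ t ⊨ B
M ⊩ s ⊨ ⊤′     = ⊤
M ⊩ s ⊨ ⊥′     = ⊥
M ⊩ s ⊨ A ∨ B  = M ⊩ s ⊨ A ⊎ M ⊩ s ⊨ B
M ⊩ s ⊨ A ∧ B  = M ⊩ s ⊨ A × M ⊩ s ⊨ B
M ⊩ s ⊨ ◇ A    = let open Model M in ∃[ t ] ∃[ u ] t ≤ s × R t u × M ⊩ u ⊨ A
M ⊩ s ⊨ □ A    = let open Model M in ∀ t → t ≥ s → ∀ u → R t u → M ⊩ u ⊨ A
M ⊩ s ⊨ ⧫ A    = let open Model M in ∀ t → t ≥ s → ∃[ u ] R t u × M ⊩ u ⊨ A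
M ⊩ s ⊨ ■ A    = let open Model M in ∃[ t ] t ≤ s × (∀ u → R t u → M ⊩ u ⊨ A)

_⊩_⊨ˢ_ : (M : Model ℓ) → Model.W M → SignedFo → Set ℓ
M ⊩ s ⊨ˢ (Sign.+ , A) = M ⊩ s ⊨ A
M ⊩ s ⊨ˢ (Sign.- , A) = ¬ (M ⊩ s ⊨ A)

Valid : Frame ℓ → SignedFo → Set (lsuc ℓ)
Valid F σ = ∀ (v : Valuation F) (s : Frame.W F) → (F ,ᵐ v) ⊩ s ⊨ˢ σ

record InferenceRule : Set where
  field
    premises   : List SignedFo
    conclusion : SignedFo

Respects : Frame ℓ → InferenceRule → Set (lsuc ℓ)
Respects F ρ = All (Valid F) premises → Valid F conclusion
  where open InferenceRule ρ

ModallyDefinable : Pred (Frame ℓ) c → (wrt : Pred (Frame ℓ) d) → Set (lsuc ℓ ⊔ c ⊔ d)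
ModallyDefinable {ℓ} C D =
  Σ[ ρ ∈ InferenceRule ] (∀ (F : Frame ℓ) → F ∈ D → (Respects F ρ ⇔ F ∈ C))

ForwardConfluent BackwardConfluent DownwardConfluent UpwardConfluent SymmetricFrame :
  Pred (Frame ℓ) ℓ
ForwardConfluent  F = let open Frame F in (_≥_ ; R) ⇒ (R ; _≥_)
BackwardConfluent F = let open Frame F in (R ; _≤_) ⇒ (_≤_ ; R)
DownwardConfluent F = let open Frame F in (_≤_ ; R) ⇒ (R ; _≤_)
UpwardConfluent   F = let open Frame F in (R ; _≥_) ⇒ (_≥_ ; R)
SymmetricFrame    F = Symmetric (Frame.R F)

Confluent : Pred (Frame ℓ) ℓ
Confluent = ForwardConfluent ∩ BackwardConfluent ∩ DownwardConfluent ∩ UpwardConfluent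

-- On an indiscrete preorder a formula holds everywhere or nowhere, so a modality
-- over a serial relation only asks whether its argument holds at all: validity does
-- not depend on which serial relation is chosen.  A reflexive relation makes an
-- indiscrete frame confluent, and on two points it can be symmetric or not.
module Submission where

open import Level using (Level; Lift; lift; lower)
open import Data.Bool.Base using (Bool; false; true; f≤t; b≤b) renaming (_≤_ to _≤ᵇ_)
open import Data.List.Relation.Unary.All using (map)
open import Data.Product.Base using (∃-syntax; _,_)
open import Data.Sign.Base using (Sign)
open import Data.Sum.Base using () renaming (map to map-⊎)
open import Data.Unit.Polymorphic using (⊤)
open import Function.Base using (_∘_)
open import Function.Bundles using (module Equivalence)
open import Relation.Binary.Core using (Rel)
open import Relation.Binary.Definitions using (Reflexive)
open import Relation.Binary.PropositionalEquality.Properties using (isEquivalence)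
open import Relation.Nullary using (¬_)
open import Defs

private
  variable
    ℓ : Level
    W : Set ℓ
    R R′ : Rel W ℓ

Serial : {W : Set ℓ} → Rel W ℓ → Set ℓ
Serial R = ∀ s → ∃[ t ] R s t

indiscrete : {W : Set ℓ} → W → Rel W ℓ → Frame ℓ
indiscrete {W = W} w R = record
  { W          = W
  ; nonempty   = w
  ; _≤_        = λ _ _ → ⊤
  ; isPreorder = record
    { isEquivalence = isEquivalence
    ; reflexive     = _
    ; trans         = _
    }
  ; R          = R
  }

-- Both frames share points and order, so the same closed sets serve. The record is rebuilt because
-- its type is indexed by the whole frame.
changeRel : {w : W} → Valuation (indiscrete w R) → Valuation (indiscrete w R′)
changeRel v = record { V = V ; closed = closed }
  where open Valuation v

-- Induction on `A`. Letting the point change along with the relation is what makes the modal cases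
-- go through, since successors under `R` and `R′` may differ.
⊨-transfer : {w : W} → Serial R → Serial R′ → (v : Valuation (indiscrete w R)) →
             ∀ A s t → (indiscrete w R ,ᵐ v) ⊩ s ⊨ A →
             (indiscrete w R′ ,ᵐ changeRel v) ⊩ t ⊨ A
⊨-transfer {R = R} {R′ = R′} {w = w} ser ser′ v = go
  where
  to : Fo → Set _
  to A = ∀ s t → (indiscrete w R ,ᵐ v) ⊩ s ⊨ A → (indiscrete w R′ ,ᵐ changeRel v) ⊩ t ⊨ A

  go : ∀ A → to A
  back : ∀ A s → ¬ ((indiscrete w R ,ᵐ v) ⊩ s ⊨ A) →
         ¬ ((indiscrete w R′ ,ᵐ changeRel v) ⊩ s ⊨ A)

  -- Any two points are comparable, so closedness spreads `p` from `s` to `t`.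
  go (atom p) s t h = Valuation.closed v p _ h
  go (A ⇀ B) s t h u _ = map-⊎ (back A u) (go B u u) (h u _)
  go (A ↽ B) s t (u , _ , ¬a , b) = u , _ , back A u ¬a , go B u u b
  go ⊤′ s t h = _
  go ⊥′ s t ()
  go (A ∨ B) s t = map-⊎ (go A s t) (go B s t)
  go (A ∧ B) s t (a , b) = go A s t a , go B s t b
  -- For `◇` and `⧫`, `ser′` provides the new witness; for `□` and `■`, `ser` provides a successor
  -- at which the hypothesis yields `A`.
  go (◇ A) s t (_ , u , _ , _ , a) =
    let u′ , r′ = ser′ t in t , u′ , _ , r′ , go A u u′ a
  go (□ A) s t h _ _ u′ _ =
    let u , r = ser s in go A u u′ (h s _ u r)
  go (⧫ A) s t h t′ _ =
    let u , _ , a = h s _ ; u′ , r′ = ser′ t′ in u′ , r′ , go A u u′ a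
  go (■ A) s t (x , _ , h) =
    let u , r = ser x in t , _ , λ u′ _ → go A u u′ (h u r)

  -- Negated arguments of `⇀` and `↽` need the converse: the same lemma with the relations
  -- exchanged. Changing the relation twice gives `v` back definitionally.
  back A s ¬a a = ¬a (⊨-transfer ser′ ser (changeRel v) A s s a)

Valid-transfer : {w : W} → Serial R → Serial R′ →
                 ∀ σ → Valid (indiscrete w R) σ → Valid (indiscrete w R′) σ
Valid-transfer ser ser′ (Sign.+ , A) valid v s =
  ⊨-transfer ser ser′ (changeRel v) A s s (valid (changeRel v) s)
Valid-transfer ser ser′ (Sign.- , A) valid v s =
  valid (changeRel v) s ∘ ⊨-transfer ser′ ser v A s s

Respects-transfer : {w : W} → Serial R → Serial R′ →
                    ∀ ρ → Respects (indiscrete w R) ρ → Respects (indiscrete w R′) ρ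
Respects-transfer ser ser′ ρ resp =
  Valid-transfer ser ser′ (InferenceRule.conclusion ρ) ∘ resp ∘
  map (λ {σ} → Valid-transfer ser′ ser σ)

reflexive⇒serial : Reflexive R → Serial R
reflexive⇒serial r s = s , r

-- The middle point is the source or the target, whichever puts the loop on the `R` step; the order
-- step is trivial.
reflexive⇒confluent : {w : W} → Reflexive R → Confluent (indiscrete w R)
reflexive⇒confluent r =
  (λ _ → _ , r , _) , (λ _ → _ , _ , r) , (λ _ → _ , r , _) , (λ _ → _ , _ , r)

proposition27 : (ℓ : Level) → ¬ ModallyDefinable {ℓ} SymmetricFrame Confluent
proposition27 ℓ (ρ , defines) = ≼-asymmetric (≼-symmetric (lift f≤t))
  where
  -- Both relations are reflexive on two points, but only `total` is symmetric. `Lift` moves the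
  -- points to level `ℓ`.
  _≼_ total : Rel (Lift ℓ Bool) ℓ
  x ≼ y     = Lift ℓ (lower x ≤ᵇ lower y)
  total _ _ = ⊤

  ≼-refl : Reflexive _≼_
  ≼-refl = lift b≤b

  module Def {R : Rel (Lift ℓ Bool) ℓ} (r : Reflexive R) =
    Equivalence (defines (indiscrete (lift false) R) (reflexive⇒confluent {w = lift false} r))

  ≼-symmetric : SymmetricFrame (indiscrete (lift false) _≼_)
  ≼-symmetric = Def.to ≼-refl
    -- Symmetry of `total` makes its frame respect `ρ`; transfer hands this to `_≼_`, which
    -- definability then forces to be symmetric.
    (Respects-transfer {R = total} (reflexive⇒serial {R = total} _)
      (reflexive⇒serial {R = _≼_} ≼-refl) ρ (Def.from {total} _ _))

  ≼-asymmetric : ¬ (lift true ≼ lift false)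
  ≼-asymmetric (lift ())
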